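{- For every integer $n\ge 0$, $$\sum_{T\in\mathcal{PT}(n)}\operatorname{sign}(T) =\frac{(1+i)^n + (1-i)^n}{2},$$ where $i$ is the imaginary unit and $\operatorname{sign}(T)=(-1)^{\operatorname{urc}(T)}$.
   Context: Ferrers diagrams: a Ferrers diagram is a left-justified arrangement of square cells, possibly with empty rows; its length is the number of rows plus the number of columns. The steps of the south-east border are labeled $1,\dots,n$ from north-east to south-west ($n$ the length); a row gets the label of its south step and a column the label of its west step. Equivalently, a diagram of length $n$ is a splitting of $\{1,\dots,n\}$ into row labels and column labels; rows are listed top to bottom in increasing order of label, columns left to right in decreasing order of label, and there is a cell in Row $r$ and Column $c$ exactly when $r<c$. Permutation tableaux: a permutation tableau is a Ferrers diagram with a filling of its cells by $0$'s and $1$'s such that (1) each column has at least one $1$; (2) there is no $0$ having both a $1$ above it in the same column and a $1$ to the left of it in the same row. $\mathcal{PT}(n)$ is the set of permutation tableaux of length $n$ ($\mathcal{PT}(0)$ consists of the single empty tableau). A column is unrestricted if it contains no $0$ that has a $1$ to the left of it in the same row; $\operatorname{urc}(T)$ is the number of unrestricted columns of $T$. -}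

module Defs where

open import Algebra.Bundles.Raw using (RawSemiring)
import Algebra.Definitions.RawSemiring as RawSemiringDefs
open import Data.Digit using (Bit; 0b; 1b)
open import Data.Fin using (Fin; zero; suc; _<_)
import Data.Fin.Properties as Fin
open import Data.Integer as ℤ using (ℤ; 0ℤ; -1ℤ; +_)
open import Data.List using (List; []; _∷_; [_]; _++_; map; allFin; filter; foldr;
  length; concatMap; cartesianProductWith)
open import Data.List.Membership.Propositional using (_∈_)
open import Data.List.Membership.Propositional.Properties using
  (∈-map⁺; ∈-map⁻; ∈-++⁺ˡ; ∈-++⁺ʳ; ∈-concatMap⁺; ∈-concatMap⁻; ∈-cartesianProductWith⁺;
   ∈-filter⁺; ∈-filter⁻)
open import Data.List.Relation.Binary.Disjoint.Propositional using (Disjoint)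
open import Data.List.Relation.Unary.All using (All; []; _∷_)
open import Data.List.Relation.Unary.AllPairs using ([]; _∷_)
open import Data.List.Relation.Unary.Any as Any using (Any; here; there)
open import Data.List.Relation.Unary.Unique.Propositional using (Unique)
import Data.List.Relation.Unary.Unique.Propositional.Properties as Unique
open import Data.Maybe using (Maybe; just; nothing)
import Data.Maybe.Properties as Maybe
open import Data.Nat using (ℕ; zero; suc; z<s; s<s; s<s⁻¹)
open import Data.Product using (Σ; ∃; ∃₂; _×_; _,_; proj₁; proj₂)
open import Data.Rational as ℚ using (ℚ; 0ℚ; 1ℚ)
open import Data.Vec using (Vec; []; _∷_; lookup)
open import Function using (_⇔_; mk⇔)
open import Relation.Binary using (DecidableEquality)
open import Relation.Binary.PropositionalEquality using (_≡_; refl; sym; trans; cong)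
open import Relation.Nullary using (¬_; Dec; yes; no)
open import Relation.Nullary.Decidable using (_×-dec_; _→-dec_; ¬?)
open import Relation.Unary using (Decidable)

------------------------------------------------------------------------
-- Ferrers diagrams

data Label : Set where
  row col : Label

_≟ᴸ_ : DecidableEquality Label
row ≟ᴸ row = yes refl
row ≟ᴸ col = no λ ()
col ≟ᴸ row = no λ ()
col ≟ᴸ col = yes refl

-- A diagram of length n is the splitting of the n border labels into row
-- labels and column labels; the label k + 1 of the border is k : Fin n.

Diagram : ℕ → Set
Diagram n = Vec Label n

Cell : ∀ {n} → Diagram n → Fin n → Fin n → Set
Cell D r c = lookup D r ≡ row × lookup D c ≡ col × r < c

------------------------------------------------------------------------
-- Fillings with 0's and 1's

-- One bit for each column label of D.

data Row : ∀ {n} → Diagram n → Set where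
  []   : Row []
  skip : ∀ {n} {D : Diagram n} → Row D → Row (row ∷ D)
  _∷_  : ∀ {n} {D : Diagram n} → Bit → Row D → Row (col ∷ D)

-- The row with the smallest label has a cell in every column of larger
-- label; the column with the smallest label has no cells at all.
-- `entry-cell` below confirms that exactly the cells of D are filled.

data Filling : ∀ {n} → Diagram n → Set where
  empty  : Filling []
  addRow : ∀ {n} {D : Diagram n} → Row D → Filling D → Filling (row ∷ D)
  addCol : ∀ {n} {D : Diagram n} → Filling D → Filling (col ∷ D)

bitAt : ∀ {n} {D : Diagram n} → Row D → Fin n → Maybe Bit
bitAt (skip ρ) zero    = nothing
bitAt (skip ρ) (suc c) = bitAt ρ c
bitAt (b ∷ ρ)  zero    = just b
bitAt (b ∷ ρ)  (suc c) = bitAt ρ c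

-- `entry F r c` is the content of the cell in Row r and Column c, and
-- `nothing` if there is no such cell.

entry : ∀ {n} {D : Diagram n} → Filling D → Fin n → Fin n → Maybe Bit
entry (addRow ρ F) zero    zero    = nothing
entry (addRow ρ F) zero    (suc c) = bitAt ρ c
entry (addRow ρ F) (suc r) zero    = nothing
entry (addRow ρ F) (suc r) (suc c) = entry F r c
entry (addCol F)   zero    _       = nothing
entry (addCol F)   (suc r) zero    = nothing
entry (addCol F)   (suc r) (suc c) = entry F r c

Tableau : ℕ → Set
Tableau n = Σ (Diagram n) Filling

------------------------------------------------------------------------
-- Permutation tableaux

module _ {n : ℕ} (T : Tableau n) where

  private
    D : Diagram n
    D = proj₁ T

  HasEntry : Bit → Fin n → Fin n → Set
  HasEntry b r c = entry (proj₂ T) r c ≡ just b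

  OneAbove : Fin n → Fin n → Set
  OneAbove r c = ∃ λ r′ → r′ < r × HasEntry 1b r′ c

  -- Columns are listed from left to right in decreasing order of label.

  OneToTheLeft : Fin n → Fin n → Set
  OneToTheLeft r c = ∃ λ c′ → c < c′ × HasEntry 1b r c′

  EachColumnHasOne : Set
  EachColumnHasOne = ∀ c → lookup D c ≡ col → ∃ λ r → HasEntry 1b r c

  NoForbiddenZero : Set
  NoForbiddenZero = ¬ ∃₂ λ r c → HasEntry 0b r c × OneAbove r c × OneToTheLeft r c

  IsPermutationTableau : Set
  IsPermutationTableau = EachColumnHasOne × NoForbiddenZero

  UnrestrictedColumn : Fin n → Set
  UnrestrictedColumn c =
    lookup D c ≡ col × ¬ (∃ λ r → HasEntry 0b r c × OneToTheLeft r c)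

  hasEntry? : ∀ b r c → Dec (HasEntry b r c)
  hasEntry? b r c = Maybe.≡-dec Fin._≟_ (entry (proj₂ T) r c) (just b)

  oneAbove? : ∀ r c → Dec (OneAbove r c)
  oneAbove? r c = Fin.any? λ r′ → (r′ Fin.<? r) ×-dec hasEntry? 1b r′ c

  oneToTheLeft? : ∀ r c → Dec (OneToTheLeft r c)
  oneToTheLeft? r c = Fin.any? λ c′ → (c Fin.<? c′) ×-dec hasEntry? 1b r c′

  isPermutationTableau? : Dec IsPermutationTableau
  isPermutationTableau? =
    Fin.all? (λ c → (lookup D c ≟ᴸ col) →-dec Fin.any? (λ r → hasEntry? 1b r c))
    ×-dec
    ¬? (Fin.any? λ r → Fin.any? λ c →
          hasEntry? 0b r c ×-dec (oneAbove? r c ×-dec oneToTheLeft? r c))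

  unrestrictedColumn? : Decidable UnrestrictedColumn
  unrestrictedColumn? c =
    (lookup D c ≟ᴸ col)
    ×-dec
    ¬? (Fin.any? λ r → hasEntry? 0b r c ×-dec oneToTheLeft? r c)

  urc : ℕ
  urc = length (filter unrestrictedColumn? (allFin n))

  sign : ℤ
  sign = -1ℤ ℤ.^ urc

------------------------------------------------------------------------
-- The set of permutation tableaux of length n, as a duplicate-free list
-- (see `∈-PT` and `PT-unique`)

allDiagrams : ∀ n → List (Diagram n)
allDiagrams zero    = [ [] ]
allDiagrams (suc n) = map (row ∷_) (allDiagrams n) ++ map (col ∷_) (allDiagrams n)

allRows : ∀ {n} (D : Diagram n) → List (Row D)
allRows []        = [ [] ]
allRows (row ∷ D) = map skip (allRows D)
allRows (col ∷ D) = map (0b ∷_) (allRows D) ++ map (1b ∷_) (allRows D)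

allFillings : ∀ {n} (D : Diagram n) → List (Filling D)
allFillings []        = [ empty ]
allFillings (row ∷ D) = cartesianProductWith addRow (allRows D) (allFillings D)
allFillings (col ∷ D) = map addCol (allFillings D)

allTableaux : ∀ n → List (Tableau n)
allTableaux n = concatMap (λ D → map (D ,_) (allFillings D)) (allDiagrams n)

PT : ∀ n → List (Tableau n)
PT n = filter isPermutationTableau? (allTableaux n)

sumOver : ∀ {A : Set} → List A → (A → ℤ) → ℤ
sumOver xs f = foldr ℤ._+_ 0ℤ (map f xs)

------------------------------------------------------------------------
-- The field ℚ(i) of Gaussian rationals, a subfield of the complex numbers

infix 4 _+i_

record ℚ[i] : Set where
  constructor _+i_
  field
    re im : ℚ

open ℚ[i] public

infixl 6 _⊕_ _⊖_
infixl 7 _⊗_ _/ℚ_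
infixr 8 _^_

_⊕_ _⊖_ _⊗_ : ℚ[i] → ℚ[i] → ℚ[i]
z ⊕ w = re z ℚ.+ re w +i im z ℚ.+ im w
z ⊖ w = re z ℚ.- re w +i im z ℚ.- im w
z ⊗ w = re z ℚ.* re w ℚ.- im z ℚ.* im w +i re z ℚ.* im w ℚ.+ im z ℚ.* re w

_/ℚ_ : ℚ[i] → (q : ℚ) → .{{ℚ.NonZero q}} → ℚ[i]
z /ℚ q = re z ℚ.÷ q +i im z ℚ.÷ q

fromℤ : ℤ → ℚ[i]
fromℤ k = k ℚ./ 1 +i 0ℚ

𝟘 𝟙 𝕚 : ℚ[i]
𝟘 = 0ℚ +i 0ℚ
𝟙 = 1ℚ +i 0ℚ
𝕚 = 0ℚ +i 1ℚ

2ℚ : ℚ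
2ℚ = + 2 ℚ./ 1

ℚ[i]-rawSemiring : RawSemiring _ _
ℚ[i]-rawSemiring = record
  { Carrier = ℚ[i] ; _≈_ = _≡_ ; _+_ = _⊕_ ; _*_ = _⊗_ ; 0# = 𝟘 ; 1# = 𝟙 }

_^_ : ℚ[i] → ℕ → ℚ[i]
_^_ = RawSemiringDefs._^_ ℚ[i]-rawSemiring

------------------------------------------------------------------------
-- Exactly the cells of a diagram are filled

bitAt-col : ∀ {n} {D : Diagram n} (ρ : Row D) c →
            (∃ λ b → bitAt ρ c ≡ just b) ⇔ (lookup D c ≡ col)
bitAt-col ρ c = mk⇔ (to ρ c) (from ρ c)
  where
  to : ∀ {n} {D : Diagram n} (ρ : Row D) c →
       (∃ λ b → bitAt ρ c ≡ just b) → lookup D c ≡ col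
  to (skip ρ) zero    (_ , ())
  to (skip ρ) (suc c) p = to ρ c p
  to (b ∷ ρ)  zero    p = refl
  to (b ∷ ρ)  (suc c) p = to ρ c p

  from : ∀ {n} {D : Diagram n} (ρ : Row D) c →
         lookup D c ≡ col → ∃ λ b → bitAt ρ c ≡ just b
  from (skip ρ) (suc c) p = from ρ c p
  from (b ∷ ρ)  zero    p = b , refl
  from (b ∷ ρ)  (suc c) p = from ρ c p

entry-cell : ∀ {n} {D : Diagram n} (F : Filling D) r c →
             (∃ λ b → entry F r c ≡ just b) ⇔ Cell D r c
entry-cell F r c = mk⇔ (to F r c) (from F r c)
  where
  open import Function using (module Equivalence)

  to : ∀ {n} {D : Diagram n} (F : Filling D) r c →
       (∃ λ b → entry F r c ≡ just b) → Cell D r c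
  to (addRow ρ F) zero    zero    (_ , ())
  to (addRow ρ F) zero    (suc c) p = refl , Equivalence.to (bitAt-col ρ c) p , z<s
  to (addRow ρ F) (suc r) zero    (_ , ())
  to (addRow ρ F) (suc r) (suc c) e = let p , q , lt = to F r c e in p , q , s<s lt
  to (addCol F)   zero    c       (_ , ())
  to (addCol F)   (suc r) zero    (_ , ())
  to (addCol F)   (suc r) (suc c) e = let p , q , lt = to F r c e in p , q , s<s lt

  from : ∀ {n} {D : Diagram n} (F : Filling D) r c →
         Cell D r c → ∃ λ b → entry F r c ≡ just b
  from (addRow ρ F) zero    zero    (_ , () , _)
  from (addRow ρ F) zero    (suc c) (_ , q , _)  = Equivalence.from (bitAt-col ρ c) q
  from (addRow ρ F) (suc r) zero    (_ , () , _)
  from (addRow ρ F) (suc r) (suc c) (p , q , lt) = from F r c (p , q , s<s⁻¹ lt)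
  from (addCol F)   zero    c       (() , _)
  from (addCol F)   (suc r) zero    (_ , _ , ())
  from (addCol F)   (suc r) (suc c) (p , q , lt) = from F r c (p , q , s<s⁻¹ lt)

------------------------------------------------------------------------
-- The enumeration is complete and free of duplicates

∈-allDiagrams : ∀ {n} (D : Diagram n) → D ∈ allDiagrams n
∈-allDiagrams []        = here refl
∈-allDiagrams (row ∷ D) = ∈-++⁺ˡ (∈-map⁺ (row ∷_) (∈-allDiagrams D))
∈-allDiagrams (col ∷ D) = ∈-++⁺ʳ _ (∈-map⁺ (col ∷_) (∈-allDiagrams D))

∈-allRows : ∀ {n} {D : Diagram n} (ρ : Row D) → ρ ∈ allRows D
∈-allRows []             = here refl
∈-allRows (skip ρ)       = ∈-map⁺ skip (∈-allRows ρ)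
∈-allRows (zero ∷ ρ)     = ∈-++⁺ˡ (∈-map⁺ (0b ∷_) (∈-allRows ρ))
∈-allRows (suc zero ∷ ρ) = ∈-++⁺ʳ _ (∈-map⁺ (1b ∷_) (∈-allRows ρ))

∈-allFillings : ∀ {n} {D : Diagram n} (F : Filling D) → F ∈ allFillings D
∈-allFillings empty        = here refl
∈-allFillings (addRow ρ F) =
  ∈-cartesianProductWith⁺ addRow (∈-allRows ρ) (∈-allFillings F)
∈-allFillings (addCol F)   = ∈-map⁺ addCol (∈-allFillings F)

∈-allTableaux : ∀ {n} (T : Tableau n) → T ∈ allTableaux n
∈-allTableaux {n} (D , F) = ∈-concatMap⁺ (λ D → map (D ,_) (allFillings D))
  (Any.map (λ { refl → ∈-map⁺ (D ,_) (∈-allFillings F) }) (∈-allDiagrams D))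

∈-PT : ∀ {n} (T : Tableau n) → (T ∈ PT n) ⇔ IsPermutationTableau T
∈-PT {n} T = mk⇔
  (λ p → proj₂ (∈-filter⁻ isPermutationTableau? {xs = allTableaux n} p))
  (∈-filter⁺ isPermutationTableau? (∈-allTableaux T))

allDiagrams-unique : ∀ n → Unique (allDiagrams n)
allDiagrams-unique zero    = [] ∷ []
allDiagrams-unique (suc n) = Unique.++⁺
  (Unique.map⁺ (λ { refl → refl }) (allDiagrams-unique n))
  (Unique.map⁺ (λ { refl → refl }) (allDiagrams-unique n))
  λ (p , q) → case (∈-map⁻ _ p) (∈-map⁻ _ q)
  where
  case : ∀ {v : Diagram (suc n)} {xs ys} → (∃ λ x → x ∈ xs × v ≡ row ∷ x) →
         ¬ (∃ λ y → y ∈ ys × v ≡ col ∷ y)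
  case (_ , _ , refl) (_ , _ , ())

allRows-unique : ∀ {n} (D : Diagram n) → Unique (allRows D)
allRows-unique []        = [] ∷ []
allRows-unique (row ∷ D) = Unique.map⁺ (λ { refl → refl }) (allRows-unique D)
allRows-unique (col ∷ D) = Unique.++⁺
  (Unique.map⁺ (λ { refl → refl }) (allRows-unique D))
  (Unique.map⁺ (λ { refl → refl }) (allRows-unique D))
  λ (p , q) → case (∈-map⁻ _ p) (∈-map⁻ _ q)
  where
  case : ∀ {v : Row (col ∷ D)} {xs ys} → (∃ λ x → x ∈ xs × v ≡ 0b ∷ x) →
         ¬ (∃ λ y → y ∈ ys × v ≡ 1b ∷ y)
  case (_ , _ , refl) (_ , _ , ())

allFillings-unique : ∀ {n} (D : Diagram n) → Unique (allFillings D)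
allFillings-unique []        = [] ∷ []
allFillings-unique (row ∷ D) = Unique.cartesianProductWith⁺ addRow
  (λ { refl → refl , refl }) (allRows-unique D) (allFillings-unique D)
allFillings-unique (col ∷ D) = Unique.map⁺ (λ { refl → refl }) (allFillings-unique D)

allTableaux-unique : ∀ n → Unique (allTableaux n)
allTableaux-unique n = go (allDiagrams-unique n)
  where
  block : Diagram n → List (Tableau n)
  block D = map (D ,_) (allFillings D)

  ∈-block : ∀ {D} {T : Tableau n} → T ∈ block D → proj₁ T ≡ D
  ∈-block p with _ , _ , refl ← ∈-map⁻ _ p = refl

  apart : ∀ {D Ds} → All (λ E → ¬ D ≡ E) Ds → Disjoint (block D) (concatMap block Ds)
  apart {Ds = Ds} D∉Ds (p , q) = distinct D∉Ds (∈-block p) (∈-concatMap⁻ block {xs = Ds} q)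
    where
    distinct : ∀ {D Ds} {T : Tableau n} → All (λ E → ¬ D ≡ E) Ds →
               proj₁ T ≡ D → ¬ Any (λ E → T ∈ block E) Ds
    distinct (D≢E ∷ _) e (here q)  = D≢E (trans (sym e) (∈-block q))
    distinct (_ ∷ D∉)  e (there q) = distinct D∉ e q

  go : ∀ {Ds} → Unique Ds → Unique (concatMap block Ds)
  go []           = []
  go {D ∷ _} (D∉ ∷ u) = Unique.++⁺
    (Unique.map⁺ (λ { refl → refl }) (allFillings-unique D)) (go u) (apart D∉)

PT-unique : ∀ n → Unique (PT n)
PT-unique n = Unique.filter⁺ isPermutationTableau? (allTableaux-unique n)

{-# OPTIONS --safe #-}

-- Read a tableau from the largest label down, so that rows are added on top and
-- columns at the right end.  Whether a partial tableau extends to a permutation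
-- tableau depends only on the status of its columns: restricted, or unrestricted
-- with or without a 1.  A new row leaves the columns left of its leftmost 1 alone;
-- right of it, a column without a 1 must receive one, and an unrestricted column
-- with a 1 stays unrestricted or becomes restricted, two choices of opposite sign.
-- After these cancellations the signed number of completions by k labels depends,
-- up to sign, only on one of five shapes of the status word.  Writing
-- (1 + i)ᵏ = x + i y, it is x, x + y, y, 2y or 0, and adding one more label is
-- multiplication by 1 + i.

module Submission where

open import Defs
open import Data.Bool using (Bool; true; false; if_then_else_)
open import Data.Digit using (Bit; 0b; 1b)
open import Data.Fin using (Fin; zero; suc; _<_)
open import Data.Integer as ℤ using (ℤ; 0ℤ; 1ℤ; -1ℤ; +_; _+_; _-_; _*_; -_)
import Data.Integer.Properties as ℤ
open import Data.Integer.Tactic.RingSolver using (solve-∀)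
open import Data.List using (List; []; _∷_; _++_; map; filter; tabulate; length;
  concatMap; cartesianProductWith)
open import Data.List.Properties using (filter-accept; filter-reject)
open import Data.Maybe using (just)
open import Data.Maybe.Properties using (just-injective)
open import Data.Nat as ℕ using (ℕ; zero; suc; z<s; s<s; s<s⁻¹)
import Data.Nat.Properties as ℕ
open import Data.Product as Product using (∃; _×_; _,_; proj₁; proj₂)
open import Data.Rational as ℚ using (ℚ; 0ℚ; 1ℚ)
import Data.Rational.Properties as ℚ
open import Data.Rational.Unnormalised as ℚᵘ using (mkℚᵘ; *≡*)
import Data.Rational.Unnormalised.Properties as ℚᵘ
open import Data.Sum using (_⊎_; inj₁; inj₂; [_,_])
open import Data.Unit using (⊤; tt)
open import Data.Vec using ([]; _∷_; lookup)
open import Function using (_∘_; id; _⇔_; mk⇔; module Equivalence)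
open import Relation.Binary.PropositionalEquality hiding ([_])
open import Relation.Nullary using (¬_; yes; no; contradiction)
open import Relation.Unary using (Decidable)

open import Algebra.Properties.Group ℚ.+-0-group using () renaming (⁻¹-involutive to -‿involutive)
open Equivalence using (to; from)
open ≡-Reasoning

private
  variable
    A B C : Set
    n : ℕ
    D : Diagram n

-- Integer sums over lists, rows and tableaux.

sumOver-cong : ∀ {f g : A → ℤ} → (∀ x → f x ≡ g x) → ∀ xs → sumOver xs f ≡ sumOver xs g
sumOver-cong f≗g []       = refl
sumOver-cong f≗g (x ∷ xs) = cong₂ _+_ (f≗g x) (sumOver-cong f≗g xs)

sumOver-++ : ∀ (f : A → ℤ) xs ys → sumOver (xs ++ ys) f ≡ sumOver xs f + sumOver ys f
sumOver-++ f []       ys = sym (ℤ.+-identityˡ _)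
sumOver-++ f (x ∷ xs) ys =
  trans (cong (_+_ (f x)) (sumOver-++ f xs ys)) (sym (ℤ.+-assoc (f x) _ _))

sumOver-map : ∀ (f : B → ℤ) (h : A → B) xs → sumOver (map h xs) f ≡ sumOver xs (λ x → f (h x))
sumOver-map f h []       = refl
sumOver-map f h (x ∷ xs) = cong (_+_ (f (h x))) (sumOver-map f h xs)

sumOver-concatMap : ∀ (f : B → ℤ) (h : A → List B) xs →
                    sumOver (concatMap h xs) f ≡ sumOver xs (λ x → sumOver (h x) f)
sumOver-concatMap f h []       = refl
sumOver-concatMap f h (x ∷ xs) =
  trans (sumOver-++ f (h x) _) (cong (_+_ (sumOver (h x) f)) (sumOver-concatMap f h xs))

sumOver-+ : ∀ (f g : A → ℤ) xs → sumOver xs (λ x → f x + g x) ≡ sumOver xs f + sumOver xs g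
sumOver-+ f g []       = refl
sumOver-+ f g (x ∷ xs) =
  trans (cong (_+_ (f x + g x)) (sumOver-+ f g xs)) (interchange (f x) (g x) _ _)
  where
  interchange : ∀ a b c d → (a + b) + (c + d) ≡ (a + c) + (b + d)
  interchange = solve-∀

sumOver-neg : ∀ (f : A → ℤ) xs → sumOver xs (λ x → - f x) ≡ - sumOver xs f
sumOver-neg f []       = refl
sumOver-neg f (x ∷ xs) =
  trans (cong (_+_ (- f x)) (sumOver-neg f xs)) (sym (ℤ.neg-distrib-+ (f x) _))

sumOver-0 : ∀ (xs : List A) → sumOver xs (λ _ → 0ℤ) ≡ 0ℤ
sumOver-0 []       = refl
sumOver-0 (x ∷ xs) = trans (ℤ.+-identityˡ _) (sumOver-0 xs)

sumOver-swap : ∀ (f : A → B → ℤ) xs ys →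
               sumOver xs (λ x → sumOver ys (f x)) ≡ sumOver ys (λ y → sumOver xs (λ x → f x y))
sumOver-swap f []       ys = sym (sumOver-0 ys)
sumOver-swap f (x ∷ xs) ys =
  trans (cong (_+_ (sumOver ys (f x))) (sumOver-swap f xs ys)) (sym (sumOver-+ (f x) _ ys))

-- The second factor is summed outermost, so that the filling below stays fixed while the added row
-- varies.
sumOver-cartesianProductWith :
  ∀ (f : C → ℤ) (h : A → B → C) xs ys →
  sumOver (cartesianProductWith h xs ys) f ≡ sumOver ys (λ y → sumOver xs (λ x → f (h x y)))
sumOver-cartesianProductWith f h xs ys = trans (go xs) (sumOver-swap (λ x y → f (h x y)) xs ys)
  where
  go : ∀ xs → sumOver (cartesianProductWith h xs ys) f ≡
              sumOver xs (λ x → sumOver ys (λ y → f (h x y)))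
  go []       = refl
  go (x ∷ xs) = trans (sumOver-++ f (map (h x) ys) _) (cong₂ _+_ (sumOver-map f (h x) ys) (go xs))

sumOver-allRows-col : ∀ (g : Row (col ∷ D) → ℤ) →
  sumOver (allRows (col ∷ D)) g ≡ sumOver (allRows D) (λ ρ → g (0b ∷ ρ) + g (1b ∷ ρ))
sumOver-allRows-col {D = D} g = begin
  sumOver (map (0b ∷_) ρs ++ map (1b ∷_) ρs) g
    ≡⟨ sumOver-++ g (map (0b ∷_) ρs) _ ⟩
  sumOver (map (0b ∷_) ρs) g + sumOver (map (1b ∷_) ρs) g
    ≡⟨ cong₂ _+_ (sumOver-map g (0b ∷_) ρs) (sumOver-map g (1b ∷_) ρs) ⟩
  sumOver ρs (λ ρ → g (0b ∷ ρ)) + sumOver ρs (λ ρ → g (1b ∷ ρ))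
    ≡⟨ sumOver-+ _ _ ρs ⟨
  sumOver ρs (λ ρ → g (0b ∷ ρ) + g (1b ∷ ρ)) ∎
  where ρs = allRows D

-- Removing the smallest label takes off either the top row or a rightmost column without cells.
sumOver-allTableaux-suc : ∀ (g : Tableau (suc n) → ℤ) →
  sumOver (allTableaux (suc n)) g ≡
  sumOver (allTableaux n) (λ (D , F) →
    sumOver (allRows D) (λ ρ → g (row ∷ D , addRow ρ F)) + g (col ∷ D , addCol F))
sumOver-allTableaux-suc {n} g = begin
  sumOver (allTableaux (suc n)) g
    ≡⟨ sumOver-concatMap g block (map (row ∷_) Ds ++ map (col ∷_) Ds) ⟩
  sumOver (map (row ∷_) Ds ++ map (col ∷_) Ds) (λ D → sumOver (block D) g)
    ≡⟨ sumOver-++ _ (map (row ∷_) Ds) _ ⟩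
  sumOver (map (row ∷_) Ds) (λ D → sumOver (block D) g) +
  sumOver (map (col ∷_) Ds) (λ D → sumOver (block D) g)
    ≡⟨ cong₂ _+_ (sumOver-map _ (row ∷_) Ds) (sumOver-map _ (col ∷_) Ds) ⟩
  sumOver Ds (λ D → sumOver (block (row ∷ D)) g) +
  sumOver Ds (λ D → sumOver (block (col ∷ D)) g)
    ≡⟨ sumOver-+ _ _ Ds ⟨
  sumOver Ds (λ D → sumOver (block (row ∷ D)) g + sumOver (block (col ∷ D)) g)
    ≡⟨ sumOver-cong (λ D → perDiagram D) Ds ⟩
  sumOver Ds (λ D → sumOver (block D) g′)
    ≡⟨ sumOver-concatMap g′ block Ds ⟨
  sumOver (allTableaux n) g′ ∎
  where
  Ds : List (Diagram n)
  Ds = allDiagrams n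

  block : ∀ {m} → Diagram m → List (Tableau m)
  block D = map (D ,_) (allFillings D)

  g′ : Tableau n → ℤ
  g′ (D , F) = sumOver (allRows D) (λ ρ → g (row ∷ D , addRow ρ F)) + g (col ∷ D , addCol F)

  perDiagram : ∀ D → sumOver (block (row ∷ D)) g + sumOver (block (col ∷ D)) g ≡
                     sumOver (block D) g′
  perDiagram D = begin
    sumOver (block (row ∷ D)) g + sumOver (block (col ∷ D)) g
      ≡⟨ cong₂ _+_
           (trans (sumOver-map g (row ∷ D ,_) (allFillings (row ∷ D)))
                  (sumOver-cartesianProductWith _ addRow (allRows D) (allFillings D)))
           (trans (sumOver-map g (col ∷ D ,_) (allFillings (col ∷ D)))
                  (sumOver-map _ addCol (allFillings D))) ⟩
    sumOver (allFillings D) (λ F → sumOver (allRows D) (λ ρ → g (row ∷ D , addRow ρ F))) +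
    sumOver (allFillings D) (λ F → g (col ∷ D , addCol F))
      ≡⟨ sumOver-+ _ _ (allFillings D) ⟨
    sumOver (allFillings D) (λ F → g′ (D , F))
      ≡⟨ sumOver-map g′ (D ,_) (allFillings D) ⟨
    sumOver (block D) g′ ∎

-- Column statuses and the weight of a status word.

-- Unrestricted columns are `fresh` (no 1 yet) or `live` (with a 1).  A
-- `restricted` column has a 1 and no forbidden zero.  A `dead` column cannot
-- belong to a permutation tableau, whatever rows are added above it.

data Status : Set where
  fresh live restricted dead : Status

data Word : ∀ {n} → Diagram n → Set where
  []   : Word []
  skip : Word D → Word (row ∷ D)
  _∷_  : Status → Word D → Word (col ∷ D)

-- The Boolean tells whether the new bit has a 1 to its left.

update : Bit → Bool → Status → Status
update zero       false s          = s
update zero       true  fresh      = dead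
update zero       true  live       = restricted
update zero       true  restricted = restricted
update (suc zero) _     fresh      = live
update (suc zero) _     live       = live
update (suc zero) _     restricted = dead
update _          _     dead       = dead

hasOne : Row D → Bool
hasOne []             = false
hasOne (skip ρ)       = hasOne ρ
hasOne (zero ∷ ρ)     = hasOne ρ
hasOne (suc zero ∷ ρ) = true

step : Row D → Word D → Word D
step []       []       = []
step (skip ρ) (skip w) = skip (step ρ w)
step (b ∷ ρ)  (s ∷ w)  = update b (hasOne ρ) s ∷ step ρ w

word : Filling D → Word D
word empty        = []
word (addRow ρ F) = skip (step ρ (word F))
word (addCol F)   = fresh ∷ word F

-- The unrestricted columns from left to right, whereas the head of a word is the
-- rightmost column: in `livesFreshes` the live ones come first.  `bad` stands for
-- a fresh column somewhere left of a live one and for words with a dead column.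

data Shape : Set where
  none lives freshes livesFreshes bad : Shape

extend : Status → Shape → Shape
extend fresh      none         = freshes
extend fresh      lives        = livesFreshes
extend fresh      freshes      = freshes
extend fresh      livesFreshes = livesFreshes
extend fresh      bad          = bad
extend live       none         = lives
extend live       lives        = lives
extend live       freshes      = bad
extend live       livesFreshes = bad
extend live       bad          = bad
extend restricted σ            = σ
extend dead       σ            = bad

shape : Word D → Shape
shape []       = none
shape (skip w) = shape w
shape (s ∷ w)  = extend s (shape w)

signOf : Status → ℤ
signOf fresh      = -1ℤ
signOf live       = -1ℤ
signOf restricted = 1ℤ
signOf dead       = 1ℤ

signum : Word D → ℤ
signum []       = 1ℤ
signum (skip w) = signum w
signum (s ∷ w)  = signOf s * signum w

-- The value on `bad` is 0 even without a dead column: a fresh column left of a live one still has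
-- to receive a 1, and in the first row with a 1 left of the live column the two choices for the
-- latter cancel.
coeff : ℤ → ℤ → Shape → ℤ
coeff x y none         = x
coeff x y lives        = x + y
coeff x y freshes      = y
coeff x y livesFreshes = y + y
coeff x y bad          = 0ℤ

-- With (1 + i)ᵏ = x + i y, this is the signed number of ways to complete a partial
-- tableau with column statuses w to a permutation tableau by k more labels.

weight : ℤ → ℤ → Word D → ℤ
weight x y w = signum w * coeff x y (shape w)

-- The effect of one new row on a status word.

step-zero : ∀ (ρ : Row D) w → hasOne ρ ≡ false → step ρ w ≡ w
step-zero []         []       h = refl
step-zero (skip ρ)   (skip w) h = cong skip (step-zero ρ w h)
step-zero (zero ∷ ρ) (s ∷ w)  h rewrite h = cong (s ∷_) (step-zero ρ w h)
step-zero (suc zero ∷ ρ) (s ∷ w) ()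

-- The column of the leftmost 1 becomes live or dead, and no column right of it stays fresh. A fresh
-- column further left therefore makes the shape `bad`; without fresh and dead columns the shape is
-- `lives`.
shape-step : ∀ (ρ : Row D) w → hasOne ρ ≡ true →
             shape (step ρ w) ≡ lives ⊎ shape (step ρ w) ≡ bad
shape-step (skip ρ) (skip w) h = shape-step ρ w h
shape-step (zero ∷ ρ) (fresh ∷ w) h rewrite h = inj₂ refl
shape-step (zero ∷ ρ) (live ∷ w) h rewrite h = shape-step ρ w h
shape-step (zero ∷ ρ) (restricted ∷ w) h rewrite h = shape-step ρ w h
shape-step (zero ∷ ρ) (dead ∷ w) h rewrite h = inj₂ refl
shape-step (suc zero ∷ ρ) (fresh ∷ w) h with shape (step ρ w)
... | none         = inj₁ refl
... | lives        = inj₁ refl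
... | freshes      = inj₂ refl
... | livesFreshes = inj₂ refl
... | bad          = inj₂ refl
shape-step (suc zero ∷ ρ) (live ∷ w) h = shape-step (suc zero ∷ ρ) (fresh ∷ w) h
shape-step (suc zero ∷ ρ) (restricted ∷ w) h = inj₂ refl
shape-step (suc zero ∷ ρ) (dead ∷ w) h = inj₂ refl

zeroRow : ℤ → Row D → ℤ
zeroRow a ρ = if hasOne ρ then 0ℤ else a

-- Exactly one row has no 1.
sumOver-zeroRow : ∀ (D : Diagram n) a → sumOver (allRows D) (zeroRow a) ≡ a
sumOver-zeroRow []        a = ℤ.+-identityʳ a
sumOver-zeroRow (row ∷ D) a =
  trans (sumOver-map (zeroRow a) skip (allRows D)) (sumOver-zeroRow D a)
sumOver-zeroRow (col ∷ D) a = begin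
  sumOver (allRows (col ∷ D)) (zeroRow a)
    ≡⟨ sumOver-allRows-col {D = D} (zeroRow a) ⟩
  sumOver (allRows D) (λ ρ → zeroRow a ρ + 0ℤ)
    ≡⟨ sumOver-cong (λ ρ → ℤ.+-identityʳ (zeroRow a ρ)) (allRows D) ⟩
  sumOver (allRows D) (zeroRow a)
    ≡⟨ sumOver-zeroRow D a ⟩
  a ∎

-- Weights summed over one added label.

module _ (x y : ℤ) where

  weight-restricted : ∀ (w : Word D) → weight x y (restricted ∷ w) ≡ weight x y w
  weight-restricted w = cong (_* coeff x y (shape w)) (ℤ.*-identityˡ (signum w))

  weight-dead : ∀ (w : Word D) → weight x y (dead ∷ w) ≡ 0ℤ
  weight-dead w = ℤ.*-zeroʳ (signum (dead ∷ w))

  -- After a row with a 1 only the shapes `lives` and `bad` occur. A further live column on the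
  -- right preserves both, so only the sign flips.
  weight-live-step : ∀ (ρ : Row D) w → hasOne ρ ≡ true →
                     weight x y (live ∷ step ρ w) ≡ - weight x y (step ρ w)
  weight-live-step ρ w h with shape (step ρ w) | shape-step ρ w h
  ... | _ | inj₁ refl = lemma (signum (step ρ w)) (x + y)
    where
    lemma : ∀ a b → (-1ℤ * a) * b ≡ - (a * b)
    lemma = solve-∀
  ... | _ | inj₂ refl = lemma (signum (step ρ w))
    where
    lemma : ∀ a → (-1ℤ * a) * 0ℤ ≡ - (a * 0ℤ)
    lemma = solve-∀

  rowSum : Word D → ℤ
  rowSum {D = D} w = sumOver (allRows D) (λ ρ → weight x y (step ρ w))

  private
    pair : Status → Word D → Row D → ℤ
    pair s w ρ = weight x y (step (0b ∷ ρ) (s ∷ w)) + weight x y (step (1b ∷ ρ) (s ∷ w))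

  rowSum-∷ : ∀ s (w : Word D) {f} → (∀ ρ → pair s w ρ ≡ f ρ) →
             rowSum (s ∷ w) ≡ sumOver (allRows D) f
  rowSum-∷ {D = D} s w eq =
    trans (sumOver-allRows-col {D = D} _) (sumOver-cong eq (allRows D))

  -- The bit is forced: a 0 keeps the column restricted, a 1 kills it.
  rowSum-restricted : ∀ (w : Word D) → rowSum (restricted ∷ w) ≡ rowSum w
  rowSum-restricted w = rowSum-∷ restricted w λ ρ →
    trans (cong₂ _+_ (trans (zeroBit ρ) (weight-restricted (step ρ w))) (weight-dead (step ρ w)))
          (ℤ.+-identityʳ _)
    where
    zeroBit : ∀ ρ → weight x y (step (0b ∷ ρ) (restricted ∷ w)) ≡
                    weight x y (restricted ∷ step ρ w)
    zeroBit ρ with hasOne ρ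
    ... | false = refl
    ... | true  = refl

  rowSum-dead : ∀ (w : Word D) → rowSum (dead ∷ w) ≡ 0ℤ
  rowSum-dead {D = D} w = trans (rowSum-∷ dead w eq) (sumOver-0 (allRows D))
    where
    eq : ∀ ρ → pair dead w ρ ≡ 0ℤ
    eq ρ with hasOne ρ
    ... | false = cong₂ _+_ (weight-dead (step ρ w)) (weight-dead (step ρ w))
    ... | true  = cong₂ _+_ (weight-dead (step ρ w)) (weight-dead (step ρ w))

  -- With a 1 to the left, bit 0 makes the column restricted and bit 1 keeps it live, with opposite
  -- weights. Only the row without a 1 to the left survives, and there either bit changes nothing.
  rowSum-live : ∀ (w : Word D) →
                rowSum (live ∷ w) ≡ weight x y (live ∷ w) + weight x y (live ∷ w)
  rowSum-live {D = D} w = trans (rowSum-∷ live w eq) (sumOver-zeroRow D _)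
    where
    eq : ∀ ρ → pair live w ρ ≡ zeroRow (weight x y (live ∷ w) + weight x y (live ∷ w)) ρ
    eq ρ with hasOne ρ in h
    ... | false rewrite step-zero ρ w h = refl
    ... | true  = trans
      (cong₂ _+_ (weight-restricted (step ρ w)) (weight-live-step ρ w h))
      (ℤ.+-inverseʳ (weight x y (step ρ w)))

  -- With a 1 to the left, bit 0 kills the column and bit 1 makes it live, contributing
  -- `- weight x y (step ρ w)`. The row without a 1 to the left contributes the weights of
  -- `fresh ∷ w` and `live ∷ w` instead; the term `weight x y w` compensates for its share of
  -- `- rowSum w`.
  rowSum-fresh : ∀ (w : Word D) →
                 rowSum (fresh ∷ w) ≡
                 - rowSum w + (weight x y w + weight x y (fresh ∷ w) + weight x y (live ∷ w))
  rowSum-fresh {D = D} w = begin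
    rowSum (fresh ∷ w)
      ≡⟨ rowSum-∷ fresh w eq ⟩
    sumOver (allRows D) (λ ρ → - weight x y (step ρ w) + zeroRow a ρ)
      ≡⟨ sumOver-+ _ _ (allRows D) ⟩
    sumOver (allRows D) (λ ρ → - weight x y (step ρ w)) + sumOver (allRows D) (zeroRow a)
      ≡⟨ cong₂ _+_ (sumOver-neg _ (allRows D)) (sumOver-zeroRow D a) ⟩
    - rowSum w + a ∎
    where
    a : ℤ
    a = weight x y w + weight x y (fresh ∷ w) + weight x y (live ∷ w)

    lemma : ∀ a b c → b + c ≡ - a + (a + b + c)
    lemma = solve-∀

    eq : ∀ ρ → pair fresh w ρ ≡ - weight x y (step ρ w) + zeroRow a ρ
    eq ρ with hasOne ρ in h
    ... | false rewrite step-zero ρ w h = lemma (weight x y w) _ _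
    ... | true  = trans
      (cong₂ _+_ (weight-dead (step ρ w)) (weight-live-step ρ w h))
      (ℤ.+-comm 0ℤ (- weight x y (step ρ w)))

  -- What `weight-suc` becomes for a live head once the sign is factored out.
  coeff-live : ∀ σ → coeff x y (extend live σ) + coeff x y (extend live σ) +
                     - coeff x y (extend fresh (extend live σ)) ≡
                     coeff (x - y) (x + y) (extend live σ)
  coeff-live none         = lemma x y
    where
    lemma : ∀ x y → x + y + (x + y) + - (y + y) ≡ x - y + (x + y)
    lemma = solve-∀
  coeff-live lives        = coeff-live none
  coeff-live freshes      = refl
  coeff-live livesFreshes = refl
  coeff-live bad          = refl

  -- The analogue for a fresh head; the first summand comes from the induction hypothesis for the
  -- tail.
  coeff-fresh : ∀ σ → - coeff (x - y) (x + y) σ +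
                      (coeff x y σ - (coeff x y (extend fresh σ) + coeff x y (extend fresh σ)) -
                       coeff x y (extend live σ) + coeff x y (extend fresh (extend fresh σ))) ≡
                      - coeff (x - y) (x + y) (extend fresh σ)
  coeff-fresh none         = lemma x y
    where
    lemma : ∀ x y → - (x - y) + (x - (y + y) - (x + y) + y) ≡ - (x + y)
    lemma = solve-∀
  coeff-fresh lives        = lemma x y
    where
    lemma : ∀ x y → - (x - y + (x + y)) + (x + y - (y + y + (y + y)) - (x + y) + (y + y)) ≡
                    - (x + y + (x + y))
    lemma = solve-∀
  coeff-fresh freshes      = lemma x y
    where
    lemma : ∀ x y → - (x + y) + (y - (y + y) - 0ℤ + y) ≡ - (x + y)
    lemma = solve-∀
  coeff-fresh livesFreshes = lemma x y
    where
    lemma : ∀ x y → - (x + y + (x + y)) + (y + y - (y + y + (y + y)) - 0ℤ + (y + y)) ≡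
                    - (x + y + (x + y))
    lemma = solve-∀
  coeff-fresh bad          = refl

  -- The next label adds either a row on top, giving `rowSum w`, or a cell-free column at the right
  -- end, giving `fresh ∷ w`. The pair (x - y, x + y) is x + i y multiplied by 1 + i.
  weight-suc : ∀ (w : Word D) →
               rowSum w + weight x y (fresh ∷ w) ≡ weight (x - y) (x + y) w
  weight-suc [] = lemma x y
    where
    lemma : ∀ x y → (1ℤ * x + 0ℤ) + (-1ℤ * 1ℤ) * y ≡ 1ℤ * (x - y)
    lemma = solve-∀
  weight-suc {D = row ∷ D} (skip w) =
    trans (cong (_+ weight x y (fresh ∷ skip w)) (sumOver-map _ skip (allRows D))) (weight-suc w)
  weight-suc (restricted ∷ w) = begin
    rowSum (restricted ∷ w) + weight x y (fresh ∷ restricted ∷ w)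
      ≡⟨ cong₂ _+_ (rowSum-restricted w)
           (cong (λ z → (-1ℤ * z) * coeff x y (shape (fresh ∷ w))) (ℤ.*-identityˡ (signum w))) ⟩
    rowSum w + weight x y (fresh ∷ w)
      ≡⟨ weight-suc w ⟩
    weight (x - y) (x + y) w
      ≡⟨ cong (_* coeff (x - y) (x + y) (shape w)) (ℤ.*-identityˡ (signum w)) ⟨
    weight (x - y) (x + y) (restricted ∷ w) ∎
  weight-suc (dead ∷ w) =
    trans (cong₂ _+_ (rowSum-dead w) (ℤ.*-zeroʳ (signum (fresh ∷ dead ∷ w))))
          (sym (ℤ.*-zeroʳ (signum (dead ∷ w))))
  weight-suc (live ∷ w) = begin
    rowSum (live ∷ w) + weight x y (fresh ∷ live ∷ w)
      ≡⟨ cong (_+ weight x y (fresh ∷ live ∷ w)) (rowSum-live w) ⟩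
    weight x y (live ∷ w) + weight x y (live ∷ w) + weight x y (fresh ∷ live ∷ w)
      ≡⟨ factor (signum (live ∷ w)) (coeff x y (shape (live ∷ w))) _ ⟩
    signum (live ∷ w) * (coeff x y (shape (live ∷ w)) + coeff x y (shape (live ∷ w)) +
                         - coeff x y (shape (fresh ∷ live ∷ w)))
      ≡⟨ cong (signum (live ∷ w) *_) (coeff-live (shape w)) ⟩
    weight (x - y) (x + y) (live ∷ w) ∎
    where
    factor : ∀ e a b → e * a + e * a + (-1ℤ * e) * b ≡ e * (a + a + - b)
    factor = solve-∀
  weight-suc (fresh ∷ w) = begin
    rowSum (fresh ∷ w) + φ (fresh ∷ fresh ∷ w)
      ≡⟨ cong (_+ φ (fresh ∷ fresh ∷ w)) (rowSum-fresh w) ⟩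
    - rowSum w + (φ w + φ (fresh ∷ w) + φ (live ∷ w)) + φ (fresh ∷ fresh ∷ w)
      -- Adding and subtracting `φ (fresh ∷ w)` exposes the left-hand side of the induction
      -- hypothesis.
      ≡⟨ regroup (rowSum w) (φ w) (φ (fresh ∷ w)) (φ (live ∷ w)) (φ (fresh ∷ fresh ∷ w)) ⟩
    - (rowSum w + φ (fresh ∷ w)) + rest
      ≡⟨ cong (λ z → - z + rest) (weight-suc w) ⟩
    - weight (x - y) (x + y) w + rest
      ≡⟨ factor (signum w) (coeff (x - y) (x + y) (shape w)) (coeff x y (shape w))
           (coeff x y (shape (fresh ∷ w))) (coeff x y (shape (live ∷ w))) _ ⟩
    signum w * (- coeff (x - y) (x + y) (shape w) +
      (coeff x y (shape w) - (coeff x y (shape (fresh ∷ w)) + coeff x y (shape (fresh ∷ w))) -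
       coeff x y (shape (live ∷ w)) + coeff x y (shape (fresh ∷ fresh ∷ w))))
      ≡⟨ cong (signum w *_) (coeff-fresh (shape w)) ⟩
    signum w * - coeff (x - y) (x + y) (shape (fresh ∷ w))
      ≡⟨ moveSign (signum w) _ ⟩
    weight (x - y) (x + y) (fresh ∷ w) ∎
    where
    φ : ∀ {m} {E : Diagram m} → Word E → ℤ
    φ = weight x y

    rest : ℤ
    rest = φ w + (φ (fresh ∷ w) + φ (fresh ∷ w)) + φ (live ∷ w) + φ (fresh ∷ fresh ∷ w)

    regroup : ∀ r a b c d →
              - r + (a + b + c) + d ≡ - (r + b) + (a + (b + b) + c + d)
    regroup = solve-∀

    factor : ∀ e a b c d f →
      - (e * a) + (e * b + ((-1ℤ * e) * c + (-1ℤ * e) * c) + (-1ℤ * e) * d +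
                   (-1ℤ * (-1ℤ * e)) * f) ≡
      e * (- a + (b - (c + c) - d + f))
    factor = solve-∀

    moveSign : ∀ e g → e * - g ≡ (-1ℤ * e) * g
    moveSign = solve-∀

-- Powers of 1 + i and the total weight of all tableaux.

-- (1 + i)ᵏ = powRe k + i powIm k

powRe powIm : ℕ → ℤ
powRe zero    = 1ℤ
powRe (suc k) = powRe k - powIm k
powIm zero    = 0ℤ
powIm (suc k) = powRe k + powIm k

-- The number `k` of labels still to be added has to vary: stripping one label from the tableaux
-- turns `k` into `suc k`.
sumOver-weight : ∀ n k →
  sumOver (allTableaux n) (λ T → weight (powRe k) (powIm k) (word (proj₂ T))) ≡ powRe (n ℕ.+ k)
sumOver-weight zero    k = trans (ℤ.+-identityʳ _) (ℤ.*-identityˡ (powRe k))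
sumOver-weight (suc n) k = begin
  sumOver (allTableaux (suc n)) (λ T → weight (powRe k) (powIm k) (word (proj₂ T)))
    ≡⟨ sumOver-allTableaux-suc {n} (λ T → weight (powRe k) (powIm k) (word (proj₂ T))) ⟩
  sumOver (allTableaux n) (λ (D , F) →
    rowSum (powRe k) (powIm k) (word F) + weight (powRe k) (powIm k) (fresh ∷ word F))
    ≡⟨ sumOver-cong (λ (D , F) → weight-suc (powRe k) (powIm k) (word F)) (allTableaux n) ⟩
  sumOver (allTableaux n) (λ T → weight (powRe (suc k)) (powIm (suc k)) (word (proj₂ T)))
    ≡⟨ sumOver-weight n (suc k) ⟩
  powRe (n ℕ.+ suc k)
    ≡⟨ cong powRe (ℕ.+-suc n k) ⟩
  powRe (suc n ℕ.+ k) ∎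

-- The status word describes the columns of the tableau.

module _ (T : Tableau n) where

  HasOne Restricted Forbidden : Fin n → Set
  HasOne     c = ∃ λ r → HasEntry T 1b r c
  Restricted c = ∃ λ r → HasEntry T 0b r c × OneToTheLeft T r c
  Forbidden  c = ∃ λ r → HasEntry T 0b r c × OneAbove T r c × OneToTheLeft T r c

-- The first alternative for `dead` is hopeless because the missing 1 could only be added above a 0
-- that already has a 1 to its left.
Holds : Status → (One Restr Forb : Set) → Set
Holds fresh      One Restr Forb = ¬ One × ¬ Restr
Holds live       One Restr Forb = One × ¬ Restr
Holds restricted One Restr Forb = One × Restr × ¬ Forb
Holds dead       One Restr Forb = Restr × ¬ One ⊎ Forb

module _ {One Restr Forb One′ Restr′ Forb′ : Set} where

  Holds-cong : One ⇔ One′ → Restr ⇔ Restr′ → Forb ⇔ Forb′ →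
               ∀ s → Holds s One Restr Forb → Holds s One′ Restr′ Forb′
  Holds-cong o r f fresh      (¬p , ¬q)     = ¬p ∘ o .from , ¬q ∘ r .from
  Holds-cong o r f live       (p , ¬q)      = o .to p , ¬q ∘ r .from
  Holds-cong o r f restricted (p , q , ¬v)  = o .to p , r .to q , ¬v ∘ f .from
  Holds-cong o r f dead (inj₁ (q , ¬p))     = inj₁ (r .to q , ¬p ∘ o .from)
  Holds-cong o r f dead (inj₂ v)            = inj₂ (f .to v)

module _ {One Restr Forb Left One′ Restr′ Forb′ : Set} (Forb⇒Restr : Forb → Restr) where

  -- The equivalences express a new row on top: its bit has nothing above it, so new forbidden zeros
  -- arise only from a 1 placed over an old restricting zero.
  Holds-update : ∀ b l s →
                 (l ≡ true ⇔ Left) →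
                 (One′ ⇔ (b ≡ 1b ⊎ One)) →
                 (Restr′ ⇔ (b ≡ 0b × Left ⊎ Restr)) →
                 (Forb′ ⇔ (b ≡ 1b × Restr ⊎ Forb)) →
                 Holds s One Restr Forb → Holds (update b l s) One′ Restr′ Forb′
  Holds-update zero false s l o r f h = Holds-cong
    (mk⇔ (o .from ∘ inj₂) ([ (λ ()) , id ] ∘ o .to))
    (mk⇔ (r .from ∘ inj₂) ([ (λ (_ , q) → contradiction (l .from q) λ ()) , id ] ∘ r .to))
    (mk⇔ (f .from ∘ inj₂) ([ (λ ()) , id ] ∘ f .to))
    s h
  Holds-update zero true fresh l o r f (¬p , ¬q) =
    inj₁ (r .from (inj₁ (refl , l .to refl)) , [ (λ ()) , ¬p ] ∘ o .to)
  Holds-update zero true live l o r f (p , ¬q) =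
    o .from (inj₂ p) , r .from (inj₁ (refl , l .to refl)) , [ (λ ()) , ¬q ∘ Forb⇒Restr ] ∘ f .to
  Holds-update zero true restricted l o r f (p , q , ¬v) =
    o .from (inj₂ p) , r .from (inj₂ q) , [ (λ ()) , ¬v ] ∘ f .to
  Holds-update zero true dead l o r f (inj₁ (q , ¬p)) =
    inj₁ (r .from (inj₂ q) , [ (λ ()) , ¬p ] ∘ o .to)
  Holds-update zero true dead l o r f (inj₂ v) = inj₂ (f .from (inj₂ v))
  Holds-update (suc zero) _ fresh l o r f (¬p , ¬q) =
    o .from (inj₁ refl) , [ (λ ()) , ¬q ] ∘ r .to
  Holds-update (suc zero) _ live l o r f (p , ¬q) =
    o .from (inj₁ refl) , [ (λ ()) , ¬q ] ∘ r .to
  Holds-update (suc zero) _ restricted l o r f (p , q , ¬v) = inj₂ (f .from (inj₁ (refl , q)))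
  Holds-update (suc zero) _ dead l o r f (inj₁ (q , ¬p)) = inj₂ (f .from (inj₁ (refl , q)))
  Holds-update (suc zero) _ dead l o r f (inj₂ v) = inj₂ (f .from (inj₂ v))

Describes : (Fin n → Status → Set) → {D : Diagram n} → Word D → Set
Describes P []       = ⊤
Describes P (skip w) = Describes (P ∘ suc) w
Describes P (s ∷ w)  = P zero s × Describes (P ∘ suc) w

Describes-map : ∀ {P Q : Fin n → Status → Set} (w : Word D) →
                (∀ c → lookup D c ≡ col → ∀ s → P c s → Q c s) →
                Describes P w → Describes Q w
Describes-map []       f _       = tt
Describes-map (skip w) f d       = Describes-map w (f ∘ suc) d
Describes-map (s ∷ w)  f (p , d) = f zero refl s p , Describes-map w (f ∘ suc) d

OneLeftOf : Row D → Fin n → Set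
OneLeftOf ρ c = ∃ λ c′ → c < c′ × bitAt ρ c′ ≡ just 1b

hasOne-correct : ∀ (ρ : Row D) → hasOne ρ ≡ true ⇔ ∃ λ c → bitAt ρ c ≡ just 1b
hasOne-correct []             = mk⇔ (λ ()) λ ()
hasOne-correct (skip ρ)       = mk⇔
  (Product.map suc id ∘ hasOne-correct ρ .to)
  λ { (suc c , e) → hasOne-correct ρ .from (c , e) }
hasOne-correct (zero ∷ ρ)     = mk⇔
  (Product.map suc id ∘ hasOne-correct ρ .to)
  λ { (suc c , e) → hasOne-correct ρ .from (c , e) }
hasOne-correct (suc zero ∷ ρ) = mk⇔ (λ _ → zero , refl) (λ _ → refl)

-- Column `c` sees `hasOne` of the part of `ρ` beyond it. Replacing this Boolean by any `l`
-- equivalent to `OneLeftOf ρ c` lets the hypothesis pass to the tail of `ρ`.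
Describes-step : ∀ {P Q : Fin n → Status → Set} (ρ : Row D) w →
  (∀ c b l s → bitAt ρ c ≡ just b → (l ≡ true ⇔ OneLeftOf ρ c) → P c s → Q c (update b l s)) →
  Describes P w → Describes Q (step ρ w)
Describes-step []       []       f _ = tt
Describes-step (skip ρ) (skip w) f d = Describes-step ρ w
  (λ c b l s e L → f (suc c) b l s e (mk⇔
    (λ t → let c′ , lt , e′ = L .to t in suc c′ , s<s lt , e′)
    λ { (suc c′ , lt , e′) → L .from (c′ , s<s⁻¹ lt , e′) })) d
Describes-step (b ∷ ρ)  (s ∷ w)  f (p , d) =
  f zero b (hasOne ρ) s refl (mk⇔
    (λ t → let c′ , e′ = hasOne-correct ρ .to t in suc c′ , z<s , e′)
    λ { (suc c′ , lt , e′) → hasOne-correct ρ .from (c′ , e′) }) p ,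
  Describes-step ρ w
    (λ c b l s e L → f (suc c) b l s e (mk⇔
      (λ t → let c′ , lt , e′ = L .to t in suc c′ , s<s lt , e′)
      λ { (suc c′ , lt , e′) → L .from (c′ , s<s⁻¹ lt , e′) })) d

ColumnHolds : Tableau n → Fin n → Status → Set
ColumnHolds T c s = Holds s (HasOne T c) (Restricted T c) (Forbidden T c)

module _ {n} {D : Diagram n} (ρ : Row D) (F : Filling D) where
  private
    T : Tableau n
    T = D , F

    T′ : Tableau (suc n)
    T′ = row ∷ D , addRow ρ F

  ColumnHolds-addRow : ∀ c b l s → bitAt ρ c ≡ just b → (l ≡ true ⇔ OneLeftOf ρ c) →
                       ColumnHolds T c s → ColumnHolds T′ (suc c) (update b l s)
  ColumnHolds-addRow c b l s e L = Holds-update (λ (r , e , _ , left) → r , e , left) b l s L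
    (mk⇔ (λ { (zero , e′) → inj₁ (just-injective (trans (sym e) e′))
            ; (suc r , e′) → inj₂ (r , e′) })
         λ { (inj₁ refl) → zero , e ; (inj₂ (r , e′)) → suc r , e′ })
    (mk⇔ (λ { (zero , e′ , suc c′ , lt , e″) →
                inj₁ (just-injective (trans (sym e) e′) , c′ , s<s⁻¹ lt , e″)
            ; (suc r , e′ , left) → inj₂ (r , e′ , left⁻ left) })
         λ { (inj₁ (refl , c′ , lt , e″)) → zero , e , suc c′ , s<s lt , e″
           ; (inj₂ (r , e′ , left)) → suc r , e′ , left⁺ left })
    -- A forbidden zero lies in an old row; the 1 above it is in the new row or in an old one.
    (mk⇔ (λ { (zero , _ , (_ , () , _) , _)
            ; (suc r , e′ , (zero , _ , e″) , left) →
                inj₁ (just-injective (trans (sym e) e″) , r , e′ , left⁻ left)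
            ; (suc r , e′ , (suc r′ , lt , e″) , left) →
                inj₂ (r , e′ , (r′ , s<s⁻¹ lt , e″) , left⁻ left) })
         λ { (inj₁ (refl , r , e′ , left)) → suc r , e′ , (zero , z<s , e) , left⁺ left
           ; (inj₂ (r , e′ , (r′ , lt , e″) , left)) →
               suc r , e′ , (suc r′ , s<s lt , e″) , left⁺ left })
    where
    left⁺ : ∀ {r} → OneToTheLeft T r c → OneToTheLeft T′ (suc r) (suc c)
    left⁺ (c′ , lt , e) = suc c′ , s<s lt , e

    left⁻ : ∀ {r} → OneToTheLeft T′ (suc r) (suc c) → OneToTheLeft T r c
    left⁻ (suc c′ , lt , e) = c′ , s<s⁻¹ lt , e

module _ {n} {D : Diagram n} (F : Filling D) where
  private
    T : Tableau n
    T = D , F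

    T′ : Tableau (suc n)
    T′ = col ∷ D , addCol F

  ColumnHolds-addCol : ∀ c s → ColumnHolds T c s → ColumnHolds T′ (suc c) s
  ColumnHolds-addCol c s = Holds-cong
    (mk⇔ (λ (r , e) → suc r , e) λ { (suc r , e) → r , e })
    (mk⇔ (λ (r , e , left) → suc r , e , left⁺ left)
         λ { (suc r , e , left) → r , e , left⁻ left })
    (mk⇔ (λ (r , e , (r′ , lt , e′) , left) → suc r , e , (suc r′ , s<s lt , e′) , left⁺ left)
         λ { (suc r , e , (suc r′ , lt , e′) , left) →
               r , e , (r′ , s<s⁻¹ lt , e′) , left⁻ left })
    s
    where
    left⁺ : ∀ {r} → OneToTheLeft T r c → OneToTheLeft T′ (suc r) (suc c)
    left⁺ (c′ , lt , e) = suc c′ , s<s lt , e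

    left⁻ : ∀ {r} → OneToTheLeft T′ (suc r) (suc c) → OneToTheLeft T r c
    left⁻ (suc c′ , lt , e) = c′ , s<s⁻¹ lt , e

word-correct : ∀ (F : Filling D) → Describes (ColumnHolds (D , F)) (word F)
word-correct empty        = tt
word-correct (addRow ρ F) =
  Describes-step ρ (word F) (ColumnHolds-addRow ρ F) (word-correct F)
word-correct (addCol F)   =
  -- The column of smallest label has no cells, so it starts out fresh.
  ((λ { (zero , ()) ; (suc r , ()) }) , λ { (zero , () , _) ; (suc r , () , _) }) ,
  Describes-map (word F) (λ c _ s → ColumnHolds-addCol F c s) (word-correct F)

-- With no labels left, the weight is the sign or 0.

weight-fresh : ∀ (w : Word D) → weight 1ℤ 0ℤ (fresh ∷ w) ≡ 0ℤ
weight-fresh w = trans (cong (signum (fresh ∷ w) *_) (coeff≡0 (shape w)))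
                       (ℤ.*-zeroʳ (signum (fresh ∷ w)))
  where
  -- Every shape with a fresh column has a multiple of `y` or 0 as coefficient.
  coeff≡0 : ∀ σ → coeff 1ℤ 0ℤ (extend fresh σ) ≡ 0ℤ
  coeff≡0 none         = refl
  coeff≡0 lives        = refl
  coeff≡0 freshes      = refl
  coeff≡0 livesFreshes = refl
  coeff≡0 bad          = refl

weight-live : ∀ (w : Word D) → weight 1ℤ 0ℤ (live ∷ w) ≡ -1ℤ * weight 1ℤ 0ℤ w
weight-live w = trans (ℤ.*-assoc -1ℤ (signum w) _)
                      (cong (λ z → -1ℤ * (signum w * z)) (coeff-extend (shape w)))
  where
  coeff-extend : ∀ σ → coeff 1ℤ 0ℤ (extend live σ) ≡ coeff 1ℤ 0ℤ σ
  coeff-extend none         = refl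
  coeff-extend lives        = refl
  coeff-extend freshes      = refl
  coeff-extend livesFreshes = refl
  coeff-extend bad          = refl

-- A fresh or dead column makes the weight vanish; otherwise all columns are live or restricted. In
-- use, `G` says that a column has a 1 and no forbidden zero.
weight≡0⊎columns : ∀ {P : Fin n → Status → Set} {G : Fin n → Set} (w : Word D) →
  (∀ c → P c live → G c) → (∀ c → P c restricted → G c) → Describes P w →
  weight 1ℤ 0ℤ w ≡ 0ℤ ⊎ (∀ c → lookup D c ≡ col → G c)
weight≡0⊎columns []       gl gr d = inj₂ λ ()
weight≡0⊎columns (skip w) gl gr d with weight≡0⊎columns w (gl ∘ suc) (gr ∘ suc) d
... | inj₁ z = inj₁ z
... | inj₂ g = inj₂ λ { (suc c) → g c }
weight≡0⊎columns (fresh ∷ w) gl gr d = inj₁ (weight-fresh w)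
weight≡0⊎columns (live ∷ w) gl gr (p , d) with weight≡0⊎columns w (gl ∘ suc) (gr ∘ suc) d
... | inj₁ z = inj₁ (trans (weight-live w) (cong (-1ℤ *_) z))
... | inj₂ g = inj₂ λ { zero _ → gl zero p ; (suc c) → g c }
weight≡0⊎columns (restricted ∷ w) gl gr (p , d) with weight≡0⊎columns w (gl ∘ suc) (gr ∘ suc) d
... | inj₁ z = inj₁ (trans (weight-restricted 1ℤ 0ℤ w) z)
... | inj₂ g = inj₂ λ { zero _ → gr zero p ; (suc c) → g c }
weight≡0⊎columns (dead ∷ w) gl gr d = inj₁ (weight-dead 1ℤ 0ℤ w)

module _ {U : A → Set} (U? : Decidable U) where

  LiveIff : A → Status → Set
  LiveIff a s = s ≡ live × U a ⊎ s ≡ restricted × ¬ U a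

  -- Each live column contributes a factor -1. The map `f` is arbitrary because the tail of
  -- `tabulate f` is `tabulate (f ∘ suc)`; `allFin` is the case `id`.
  sign≡weight : ∀ {n} {D : Diagram n} (f : Fin n → A) (w : Word D) →
    (∀ c → lookup D c ≡ row → ¬ U (f c)) → Describes (LiveIff ∘ f) w →
    -1ℤ ℤ.^ length (filter U? (tabulate f)) ≡ weight 1ℤ 0ℤ w
  sign≡weight f []       ¬u d = refl
  sign≡weight f (skip w) ¬u d = trans
    (cong (λ xs → -1ℤ ℤ.^ length xs) (filter-reject U? (¬u zero refl)))
    (sign≡weight (f ∘ suc) w (¬u ∘ suc) d)
  sign≡weight f (live ∷ w) ¬u (inj₁ (_ , u) , d) = begin
    -1ℤ ℤ.^ length (filter U? (tabulate f))
      ≡⟨ cong (λ xs → -1ℤ ℤ.^ length xs) (filter-accept U? u) ⟩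
    -1ℤ * -1ℤ ℤ.^ length (filter U? (tabulate (f ∘ suc)))
      ≡⟨ cong (-1ℤ *_) (sign≡weight (f ∘ suc) w (¬u ∘ suc) d) ⟩
    -1ℤ * weight 1ℤ 0ℤ w
      ≡⟨ weight-live w ⟨
    weight 1ℤ 0ℤ (live ∷ w) ∎
  sign≡weight f (restricted ∷ w) ¬u (inj₂ (_ , ¬u₀) , d) = begin
    -1ℤ ℤ.^ length (filter U? (tabulate f))
      ≡⟨ cong (λ xs → -1ℤ ℤ.^ length xs) (filter-reject U? ¬u₀) ⟩
    -1ℤ ℤ.^ length (filter U? (tabulate (f ∘ suc)))
      ≡⟨ sign≡weight (f ∘ suc) w (¬u ∘ suc) d ⟩
    weight 1ℤ 0ℤ w
      ≡⟨ weight-restricted 1ℤ 0ℤ w ⟨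
    weight 1ℤ 0ℤ (restricted ∷ w) ∎

module _ {n} (T : Tableau n) where
  private
    D′ : Diagram n
    D′ = proj₁ T

    w : Word D′
    w = word (proj₂ T)

  isPT⇒sign≡weight : IsPermutationTableau T → sign T ≡ weight 1ℤ 0ℤ w
  isPT⇒sign≡weight (ones , noForbidden) = sign≡weight (unrestrictedColumn? T) id w
    (λ c isRow (isCol , _) → contradiction (trans (sym isRow) isCol) λ ())
    (Describes-map w liveIff (word-correct (proj₂ T)))
    where
    liveIff : ∀ c → lookup D′ c ≡ col → ∀ s → ColumnHolds T c s →
              LiveIff (unrestrictedColumn? T) c s
    liveIff c isCol fresh      (¬p , _)        = contradiction (ones c isCol) ¬p
    liveIff c isCol live       (_ , ¬q)        = inj₁ (refl , isCol , ¬q)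
    liveIff c isCol restricted (_ , q , _)     = inj₂ (refl , λ (_ , ¬q) → ¬q q)
    liveIff c isCol dead       (inj₁ (_ , ¬p)) = contradiction (ones c isCol) ¬p
    liveIff c isCol dead       (inj₂ (r , v))  = contradiction (r , c , v) noForbidden

  ¬isPT⇒weight≡0 : ¬ IsPermutationTableau T → weight 1ℤ 0ℤ w ≡ 0ℤ
  ¬isPT⇒weight≡0 ¬pt
    with weight≡0⊎columns {G = λ c → HasOne T c × ¬ Forbidden T c} w
           (λ c (p , ¬q) → p , λ (r , e , _ , left) → ¬q (r , e , left))
           (λ c (p , _ , ¬v) → p , ¬v)
           (word-correct (proj₂ T))
  ... | inj₁ z    = z
  ... | inj₂ good = contradiction
    ( (λ c isCol → proj₁ (good c isCol))
    -- Only cells have entries, so `c` is a column label, as `good` requires.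
    , λ (r , c , e , v) →
        proj₂ (good c (proj₁ (proj₂ (entry-cell (proj₂ T) r c .to (0b , e))))) (r , e , v))
    ¬pt

-- Trades the filter for a summand vanishing off `P`, so that the sum can run over all tableaux,
-- which are built recursively.
sumOver-filter : ∀ {P : A → Set} (P? : Decidable P) {f g : A → ℤ} →
                 (∀ x → P x → f x ≡ g x) → (∀ x → ¬ P x → g x ≡ 0ℤ) →
                 ∀ xs → sumOver (filter P? xs) f ≡ sumOver xs g
sumOver-filter P? f≡g g≡0 []       = refl
sumOver-filter P? {f} {g} f≡g g≡0 (x ∷ xs) with P? x
... | yes p = cong₂ _+_ (f≡g x p) (sumOver-filter P? f≡g g≡0 xs)
... | no ¬p = begin
  sumOver (filter P? xs) f ≡⟨ sumOver-filter P? f≡g g≡0 xs ⟩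
  sumOver xs g             ≡⟨ ℤ.+-identityˡ _ ⟨
  0ℤ + sumOver xs g        ≡⟨ cong (_+ sumOver xs g) (g≡0 x ¬p) ⟨
  g x + sumOver xs g       ∎

sumOver-PT : ∀ n → sumOver (PT n) sign ≡ powRe n
sumOver-PT n = begin
  sumOver (PT n) sign
    ≡⟨ sumOver-filter isPermutationTableau? isPT⇒sign≡weight ¬isPT⇒weight≡0 (allTableaux n) ⟩
  sumOver (allTableaux n) (λ T → weight 1ℤ 0ℤ (word (proj₂ T)))
    -- The parameters 1 and 0 are the real and imaginary parts of the zeroth power of 1 + i.
    ≡⟨ sumOver-weight n 0 ⟩
  powRe (n ℕ.+ 0)
    ≡⟨ cong powRe (ℕ.+-identityʳ n) ⟩
  powRe n ∎

-- Evaluation in the Gaussian rationals.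

ι : ℤ → ℚ
ι k = k ℚ./ 1

-- Normalisation by a gcd blocks computation for variable `k` and `l`, so the identity is checked on
-- unnormalised fractions; the 0 in `mkℚᵘ k 0` encodes denominator 1.
ι-+ : ∀ k l → ι (k + l) ≡ ι k ℚ.+ ι l
ι-+ k l = ℚ.toℚᵘ-injective (begin′
  ℚ.toℚᵘ (ι (k + l))
    ≈⟨ ℚ.toℚᵘ-fromℚᵘ (mkℚᵘ (k + l) 0) ⟩
  mkℚᵘ (k + l) 0
    ≈⟨ *≡* (lemma k l) ⟩
  mkℚᵘ k 0 ℚᵘ.+ mkℚᵘ l 0
    ≈⟨ ℚᵘ.+-cong (ℚ.toℚᵘ-fromℚᵘ (mkℚᵘ k 0)) (ℚ.toℚᵘ-fromℚᵘ (mkℚᵘ l 0)) ⟨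
  ℚ.toℚᵘ (ι k) ℚᵘ.+ ℚ.toℚᵘ (ι l)
    ≈⟨ ℚ.toℚᵘ-homo-+ (ι k) (ι l) ⟨
  ℚ.toℚᵘ (ι k ℚ.+ ι l) ∎′)
  where
  open ℚᵘ.≃-Reasoning using (step-≈-⟩; step-≈-⟨)
    renaming (begin_ to begin′_; _∎ to _∎′)

  lemma : ∀ k l → (k + l) * 1ℤ ≡ (k * 1ℤ + l * 1ℤ) * 1ℤ
  lemma = solve-∀

ι-neg : ∀ k → ι (- k) ≡ ℚ.- ι k
ι-neg (+ zero)   = refl
ι-neg (ℤ.+[1+ n ]) = refl
-- Here `ι` itself computes to the negative of a positive fraction.
ι-neg (ℤ.-[1+ n ]) = sym (-‿involutive _)

ι-- : ∀ k l → ι (k - l) ≡ ι k ℚ.- ι l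
ι-- k l = trans (ι-+ k (- l)) (cong (ι k ℚ.+_) (ι-neg l))

[1+i]^n : ∀ n → (𝟙 ⊕ 𝕚) ^ n ≡ (ι (powRe n) +i ι (powIm n))
[1+i]^n zero    = refl
[1+i]^n (suc n) = trans (cong ((𝟙 ⊕ 𝕚) ⊗_) ([1+i]^n n)) (cong₂ _+i_
  (trans (cong₂ ℚ._-_ (ℚ.*-identityˡ a) (ℚ.*-identityˡ b)) (sym (ι-- (powRe n) (powIm n))))
  (begin
    1ℚ ℚ.* b ℚ.+ 1ℚ ℚ.* a     ≡⟨ cong₂ ℚ._+_ (ℚ.*-identityˡ b) (ℚ.*-identityˡ a) ⟩
    b ℚ.+ a                   ≡⟨ ℚ.+-comm b a ⟩
    a ℚ.+ b                   ≡⟨ ι-+ (powRe n) (powIm n) ⟨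
    ι (powRe n + powIm n)     ∎))
  where
  a = ι (powRe n)
  b = ι (powIm n)

[1-i]^n : ∀ n → (𝟙 ⊖ 𝕚) ^ n ≡ (ι (powRe n) +i ℚ.- ι (powIm n))
[1-i]^n zero    = refl
[1-i]^n (suc n) = trans (cong ((𝟙 ⊖ 𝕚) ⊗_) ([1-i]^n n)) (cong₂ _+i_
  (begin
    1ℚ ℚ.* a ℚ.- (ℚ.- 1ℚ) ℚ.* (ℚ.- b)
      ≡⟨ cong₂ ℚ._-_ (ℚ.*-identityˡ a) (neg-1* (ℚ.- b)) ⟩
    a ℚ.- (ℚ.- (ℚ.- b))
      ≡⟨ cong (a ℚ.+_) (-‿involutive (ℚ.- b)) ⟩
    a ℚ.- b
      ≡⟨ ι-- (powRe n) (powIm n) ⟨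
    ι (powRe n - powIm n) ∎)
  (begin
    1ℚ ℚ.* (ℚ.- b) ℚ.+ (ℚ.- 1ℚ) ℚ.* a
      ≡⟨ cong₂ ℚ._+_ (ℚ.*-identityˡ (ℚ.- b)) (neg-1* a) ⟩
    (ℚ.- b) ℚ.+ (ℚ.- a)
      ≡⟨ ℚ.+-comm (ℚ.- b) (ℚ.- a) ⟩
    (ℚ.- a) ℚ.+ (ℚ.- b)
      ≡⟨ ℚ.neg-distrib-+ a b ⟨
    ℚ.- (a ℚ.+ b)
      ≡⟨ cong ℚ.-_ (ι-+ (powRe n) (powIm n)) ⟨
    ℚ.- ι (powRe n + powIm n) ∎))
  where
  a = ι (powRe n)
  b = ι (powIm n)

  neg-1* : ∀ p → (ℚ.- 1ℚ) ℚ.* p ≡ ℚ.- p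
  neg-1* p = trans (sym (ℚ.neg-distribˡ-* 1ℚ p)) (cong ℚ.-_ (ℚ.*-identityˡ p))

halve-double : ∀ p → (p ℚ.+ p) ℚ.÷ 2ℚ ≡ p
halve-double p = begin
  (p ℚ.+ p) ℚ.* ℚ.½             ≡⟨ ℚ.*-distribʳ-+ ℚ.½ p p ⟩
  p ℚ.* ℚ.½ ℚ.+ p ℚ.* ℚ.½       ≡⟨ ℚ.*-distribˡ-+ p ℚ.½ ℚ.½ ⟨
  p ℚ.* 1ℚ                      ≡⟨ ℚ.*-identityʳ p ⟩
  p                             ∎

corollary1p3 : (n : ℕ) →
    fromℤ (sumOver (PT n) sign) ≡ ((𝟙 ⊕ 𝕚) ^ n ⊕ (𝟙 ⊖ 𝕚) ^ n) /ℚ 2ℚ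
corollary1p3 n = begin
  fromℤ (sumOver (PT n) sign)
    ≡⟨ cong fromℤ (sumOver-PT n) ⟩
  (a +i 0ℚ)
    -- The two powers are conjugate: the real parts add up to twice `a`, the imaginary parts cancel.
    ≡⟨ cong₂ _+i_ (halve-double a) (cong (ℚ._÷ 2ℚ) (ℚ.+-inverseʳ b)) ⟨
  ((a +i b) ⊕ (a +i ℚ.- b)) /ℚ 2ℚ
    ≡⟨ cong (_/ℚ 2ℚ) (cong₂ _⊕_ ([1+i]^n n) ([1-i]^n n)) ⟨
  ((𝟙 ⊕ 𝕚) ^ n ⊕ (𝟙 ⊖ 𝕚) ^ n) /ℚ 2ℚ ∎
  where
  a = ι (powRe n)
  b = ι (powIm n)
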